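{- Let $G=(V,E)$ be a finite undirected graph with $n=|V|$ and edge costs $\{c_e\}_{e\in E}$, $c_e\ge 0$, let $k$ be a positive integer, and suppose $|\delta_G(S)|\ge k$ for all $\emptyset\ne S\subsetneq V$. Let $G'=(V',E')$ be obtained from $G$ by adding two new nodes $s$ and $t$ and the edges $sv$ and $vt$, each of cost $0$, for all $v\in V$. Consider the survivable network design instance on $G'$ with the single tuple $(s,t,k+n)$. Then, for $H\subseteq E'$, the following are equivalent: (i) $H$ is a feasible solution to the cut-relative SNDP instance; (ii) $H$ is a feasible solution to the path-relative SNDP instance; (iii) $H\supseteq\delta_{G'}(s)\cup\delta_{G'}(t)$ and $H(V)$ is a feasible $k$-ECSS solution for $G$. Hence, this cut-relative (respectively, path-relative) SNDP instance is the same as $k$-ECSS on the graph $G$: since edges of $E'-E$ have cost $0$, the cost of a feasible $H$ equals the cost of the feasible $k$-ECSS solution $H(V)$.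
   Context: For a graph $D$ with node set $V_D$ and edge set $E_D$, $S\subseteq V_D$ and $Z\subseteq E_D$: $\delta_D(S)$ is the set of edges of $D$ with exactly one end in $S$ (and $\delta_D(v)=\delta_D(\{v\})$); $\delta_Z(S)=\delta_D(S)\cap Z$; $Z(S)$ is the set of edges of $Z$ with both ends in $S$. $k$-ECSS on $G$: find a minimum-cost $J\subseteq E$ that is feasible, meaning $|\delta_J(S)|\ge k$ for all $\emptyset\ne S\subsetneq V$. For an SNDP instance on a graph $G'=(V',E')$ with a single tuple $(s,t,r)$, an $s$-$t$ cut is a set $S\subseteq V'$ with $|S\cap\{s,t\}|=1$. A set $H\subseteq E'$ is feasible for path-relative SNDP if for every $F\subseteq E'$ with $|F|<r$: if $G'-F$ has an $s$-$t$ path, then $H-F$ has an $s$-$t$ path. A set $H\subseteq E'$ is feasible for cut-relative SNDP if for every $F\subseteq E'$ with $|F|<r$ and every $s$-$t$ cut $S$: $\delta_{E'-F}(S)\ne\emptyset$ implies $\delta_{H-F}(S)\ne\emptyset$ (equivalently, $|\delta_H(S)|\ge\min\{r,|\delta_{G'}(S)|\}$ for every $s$-$t$ cut $S$). In both problems the goal is a minimum-cost feasible solution. Edge sets are identified with the corresponding spanning subgraphs. -}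

module Defs where

open import Level using (Level; _⊔_; suc)
open import Algebra.Bundles using (CommutativeMonoid)
open import Data.Bool.Base using (if_then_else_; _∧_; _xor_)
open import Data.Fin.Base using (Fin; zero; splitAt; _↑ˡ_) renaming (suc to fsuc)
open import Data.Fin.Subset
open import Data.List.Base using (List; []; _∷_)
open import Data.List.Relation.Unary.Unique.Propositional using (Unique)
open import Data.Nat.Base as ℕ using (ℕ; _+_)
open import Data.Product using (Σ-syntax; ∃!; _×_; _,_; proj₁; proj₂)
open import Data.Product.Base using (map)
open import Data.Sum.Base using (_⊎_; [_,_]′)
open import Data.Vec.Base using (lookup; tabulate; _∷_)
open import Function.Base using (const)
open import Function.Bundles using (_⇔_)
open import Relation.Binary.Core using (Rel; _Preserves₂_⟶_⟶_)
open import Relation.Binary.Structures using (IsTotalOrder)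
open import Relation.Binary.PropositionalEquality.Core using (_≡_)
import Algebra.Properties.CommutativeMonoid.Sum as Sum

private
  variable
    c ℓ₁ ℓ₂ : Level
    m : ℕ

-- Parallel edges (and loops) are allowed.  The order in which `ends` lists the
-- two ends of an edge carries no meaning: every notion below is symmetric in it.

record Graph : Set where
  field
    #V   : ℕ
    #E   : ℕ
    ends : Fin #E → Fin #V × Fin #V

  Node : Set
  Node = Fin #V

  Edge : Set
  Edge = Fin #E

  NodeSet : Set
  NodeSet = Subset #V

  EdgeSet : Set
  EdgeSet = Subset #E

open Graph public

module _ (D : Graph) where

  -- δ_D(S); the two ends of a loop lie on the same side, so loops never occur.
  δ : NodeSet D → EdgeSet D
  δ S = tabulate λ e → lookup S (proj₁ (ends D e)) xor lookup S (proj₂ (ends D e))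

  -- δ_Z(S)
  δ[_] : EdgeSet D → NodeSet D → EdgeSet D
  δ[ Z ] S = δ S ∩ Z

  -- Z(S)
  induced : EdgeSet D → NodeSet D → EdgeSet D
  induced Z S =
    Z ∩ tabulate λ e → lookup S (proj₁ (ends D e)) ∧ lookup S (proj₂ (ends D e))

  Joins : Edge D → Node D → Node D → Set
  Joins e u v = ends D e ≡ (u , v) ⊎ ends D e ≡ (v , u)

  -- Walks in the spanning subgraph with edge set Z.
  data Walk (Z : EdgeSet D) : Node D → Node D → Set where
    stop : ∀ {u} → Walk Z u u
    step : ∀ {u v w} (e : Edge D) → e ∈ Z → Joins e u v → Walk Z v w → Walk Z u w

  nodes : ∀ {Z u v} → Walk Z u v → List (Node D)
  nodes {u = u} stop           = u ∷ []
  nodes {u = u} (step _ _ _ p) = u ∷ nodes p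

  Path : EdgeSet D → Node D → Node D → Set
  Path Z u v = Σ[ p ∈ Walk Z u v ] Unique (nodes p)

  FeasibleECSS : ℕ → EdgeSet D → Set
  FeasibleECSS k J =
    ∀ (S : NodeSet D) → Nonempty S → S ⊂ ⊤ → k ℕ.≤ ∣ δ[ J ] S ∣

  IsCut : (s t : Node D) → NodeSet D → Set
  IsCut s t S = ∣ S ∩ (⁅ s ⁆ ∪ ⁅ t ⁆) ∣ ≡ 1

  -- Feasibility for the SNDP instance on D with the single tuple (s , t , r);
  -- ⊤ ─ F is the edge set of D − F.

  PathRelativeFeasible : (s t : Node D) (r : ℕ) → EdgeSet D → Set
  PathRelativeFeasible s t r H =
    ∀ (F : EdgeSet D) → ∣ F ∣ ℕ.< r → Path (⊤ ─ F) s t → Path (H ─ F) s t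

  CutRelativeFeasible : (s t : Node D) (r : ℕ) → EdgeSet D → Set
  CutRelativeFeasible s t r H =
    ∀ (F : EdgeSet D) → ∣ F ∣ ℕ.< r → ∀ (S : NodeSet D) → IsCut s t S →
    Nonempty (δ[ ⊤ ─ F ] S) → Nonempty (δ[ H ─ F ] S)

-- The library has no real numbers.  Costs are taken in an arbitrary totally
-- ordered commutative monoid, of which (ℝ, +, 0, ≤) is an instance; nothing
-- else about ℝ is involved in comparing the costs of edge sets.

record OrderedCommutativeMonoid c ℓ₁ ℓ₂ : Set (suc (c ⊔ ℓ₁ ⊔ ℓ₂)) where
  field
    commutativeMonoid : CommutativeMonoid c ℓ₁
  open CommutativeMonoid commutativeMonoid public
  infix 4 _≤_
  field
    _≤_          : Rel Carrier ℓ₂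
    isTotalOrder : IsTotalOrder _≈_ _≤_
    ∙-mono-≤     : _∙_ Preserves₂ _≤_ ⟶ _≤_ ⟶ _≤_

module _ (K : OrderedCommutativeMonoid c ℓ₁ ℓ₂) where
  open OrderedCommutativeMonoid K
  open Sum commutativeMonoid using (sum)

  totalCost : (Fin m → Carrier) → Subset m → Carrier
  totalCost cost Z = sum λ e → if lookup Z e then cost e else ε

  IsMinimumCost : (Fin m → Carrier) → (Subset m → Set) → Subset m → Set ℓ₂
  IsMinimumCost cost Feasible X =
    Feasible X × (∀ Y → Feasible Y → totalCost cost X ≤ totalCost cost Y)

-- G': node 0 is s, node 1 is t, and node 2 + v is the node v of G.  The edges are
-- those of G, then one edge sv for each v, then one edge vt for each v.

module Extension (G : Graph) where

  s t : Fin (2 + #V G)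
  s = zero
  t = fsuc zero

  old : Node G → Fin (2 + #V G)
  old v = fsuc (fsuc v)

  G′ : Graph
  G′ = record
    { #V   = 2 + #V G
    ; #E   = #E G + (#V G + #V G)
    ; ends = λ e →
        [ (λ e₀ → map old old (ends G e₀))
        , (λ e₁ → [ (λ v → s , old v) , (λ v → old v , t) ]′ (splitAt (#V G) e₁))
        ]′ (splitAt (#E G) e)
    }

  oldNodes : NodeSet G′
  oldNodes = outside ∷ outside ∷ ⊤

  -- An edge set of G′ contained in E, read as an edge set of G.
  toG : EdgeSet G′ → EdgeSet G
  toG Z = tabulate λ e → lookup Z (e ↑ˡ (#V G + #V G))

  -- H(V)
  _⟨V⟩ : EdgeSet G′ → EdgeSet G
  H ⟨V⟩ = toG (induced G′ H oldNodes)

  module _ (K : OrderedCommutativeMonoid c ℓ₁ ℓ₂) where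
    open OrderedCommutativeMonoid K

    extendCost : (Edge G → Carrier) → Edge G′ → Carrier
    extendCost cost e = [ cost , const ε ]′ (splitAt (#E G) e)

    -- The problem "minimise cost over Feasible′" on G′ is the same as k-ECSS on
    -- G: H ↦ H(V) is a cost-preserving bijection between the feasible solutions,
    -- under which minimum-cost solutions correspond.
    SameAsECSS : ℕ → (Edge G → Carrier) → (EdgeSet G′ → Set) → Set (ℓ₁ ⊔ ℓ₂)
    SameAsECSS k cost Feasible′ =
        (∀ H → Feasible′ H → FeasibleECSS G k (H ⟨V⟩))
      × (∀ H → Feasible′ H →
           totalCost K (extendCost cost) H ≈ totalCost K cost (H ⟨V⟩))
      × (∀ J → FeasibleECSS G k J → ∃! _≡_ λ H → Feasible′ H × H ⟨V⟩ ≡ J)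
      × (∀ H → Feasible′ H →
           IsMinimumCost K (extendCost cost) Feasible′ H
             ⇔ IsMinimumCost K cost (FeasibleECSS G k) (H ⟨V⟩))

-- A cut of G′ separating s from t is {s} ∪ U or its complement, where U ⊆ V, and
-- for each v ∈ V it contains exactly one of the edges sv, vt.  So such a cut has
-- exactly n edges outside E, and if H contains all edges at s and t, then
-- |δ_H({s} ∪ U)| = n + |δ_{H(V)}(U)|: requiring k + n edges across {s} ∪ U is
-- requiring k edges across U.  Cut-relative feasibility implies path-relative
-- feasibility on every graph, by growing the set of nodes reachable from s.  For
-- the step from path-relative feasibility to (iii), delete F = δ_H({s} ∪ U): if G′
-- still has an s-t path then H − F has none, so |F| ≥ k + n.

{-# OPTIONS --safe #-}
module Submission where

open import Defs
open import Level using (Level)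
open import Data.Nat.Base using (ℕ; _+_; _≤_)
open import Data.Fin.Subset using (Nonempty; _⊂_; ⊤; ⁅_⁆; _∪_; _⊇_; ∣_∣)
open import Data.Product.Base using (_×_)
open import Function.Bundles using (_⇔_)

open import Algebra.Bundles using (CommutativeMonoid)
open import Data.Bool.Base using (Bool; true; false; not; _∧_; _xor_; if_then_else_)
open import Data.Bool.Properties using (¬-not; xor-comm; xor-same; ∧-identityʳ)
open import Data.Fin.Base using (Fin; zero; suc; splitAt; _↑ˡ_; _↑ʳ_)
open import Data.Fin.Properties
  using (_≟_; splitAt-↑ˡ; splitAt-↑ʳ; splitAt⁻¹-↑ˡ; splitAt⁻¹-↑ʳ)
open import Data.Fin.Subset using (Subset; _∈_; _∉_; _⊆_; _⊃_; _∩_; _─_; ∁; ⊥)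
open import Data.Fin.Subset.Induction using (⊃-wellFounded)
open import Data.Fin.Subset.Properties
open import Data.List.Membership.Propositional using () renaming (_∈_ to _∈ₗ_)
open import Data.List.Relation.Unary.All.Properties using (¬Any⇒All¬)
open import Data.List.Relation.Unary.AllPairs using ([]; _∷_)
open import Data.List.Relation.Unary.All using ([])
open import Data.List.Relation.Unary.Any using (here; there)
open import Data.List.Relation.Unary.Unique.Propositional using (Unique)
open import Data.Nat.Base using (zero; suc; _<_; _∸_)
open import Data.Nat.Properties
  using (module ≤-Reasoning; ≮⇒≥; <⇒≱; +-monoˡ-≤; +-monoʳ-≤; m∸n+n≡m
        ; m≤n+m∸n; +-cancelʳ-≤; ≤-trans; ≤-reflexive)
open import Data.Product.Base using (∃₂; _,_; proj₁; proj₂)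
open import Data.Sum.Base using (inj₁; inj₂; [_,_]′)
open import Data.Vec.Base using (lookup; tabulate; _∷_; _++_; there)
open import Data.Vec.Properties
  using (lookup∘tabulate; tabulate∘lookup; tabulate-cong; lookup-zipWith
        ; lookup-replicate; lookup-++ˡ; lookup-++ʳ; []=⇒lookup; lookup⇒[]=)
open import Function.Base using (_∘_; id; const)
open import Function.Bundles using (mk⇔; Equivalence)
open import Function.Construct.Composition using (_⇔-∘_)
open import Induction.WellFounded using (Acc; acc)
open import Relation.Binary.PropositionalEquality
  using (_≡_; refl; sym; trans; cong; cong₂; subst; module ≡-Reasoning)
open import Relation.Binary.Structures using (IsTotalOrder)
open import Relation.Nullary using (¬_; yes; no; contradiction)
import Algebra.Properties.CommutativeMonoid.Sum as Sum
import Data.List.Membership.DecPropositional as DecMembership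
import Relation.Binary.Reasoning.Setoid as SetoidReasoning

private
  variable
    n : ℕ

-- Booleans, sizes of finite subsets, sums over a split index set.

-- Here `xor` means lying on different sides of a cut. This is used to follow a walk past an edge
-- that does not cross, and to see that `vt` crosses an s-t cut whenever `sv` does not.
xor-split : ∀ a b c → a xor b ≡ false → a xor c ≡ true → b xor c ≡ true
xor-split false false c _ h = h
xor-split true  true  c _ h = h

∉⇒lookup : ∀ {p : Subset n} {x} → x ∉ p → lookup p x ≡ false
∉⇒lookup {p = p} {x} x∉p = ¬-not λ h → x∉p (lookup⇒[]= x p h)

lookup⇒∉ : ∀ {p : Subset n} {x} → lookup p x ≡ false → x ∉ p
lookup⇒∉ h x∈p with () ← trans (sym h) ([]=⇒lookup x∈p)

x∈tabulate⁺ : ∀ {f : Fin n → Bool} {x} → f x ≡ true → x ∈ tabulate f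
x∈tabulate⁺ {f = f} {x} h = lookup⇒[]= x _ (trans (lookup∘tabulate f x) h)

x∈tabulate⁻ : ∀ {f : Fin n → Bool} {x} → x ∈ tabulate f → f x ≡ true
x∈tabulate⁻ {f = f} {x} h = trans (sym (lookup∘tabulate f x)) ([]=⇒lookup h)

x∈p─q⇒x∉q : ∀ (p q : Subset n) {x} → x ∈ p ─ q → x ∉ q
x∈p─q⇒x∉q (_ ∷ p) (true ∷ q)  (there h) (there h′) = x∈p─q⇒x∉q p q h h′
x∈p─q⇒x∉q (_ ∷ p) (false ∷ q) (there h) (there h′) = x∈p─q⇒x∉q p q h h′

∣q∣<∣p∣⇒p─q≢∅ : ∀ (p q : Subset n) → ∣ q ∣ < ∣ p ∣ → Nonempty (p ─ q)
∣q∣<∣p∣⇒p─q≢∅ p q q<p with nonempty? (p ─ q)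
... | yes h = h
... | no ¬h = contradiction (p⊆q⇒∣p∣≤∣q∣ p⊆q) (<⇒≱ q<p)
  where
  p⊆q : p ⊆ q
  p⊆q {x} x∈p with x ∈? q
  ... | yes x∈q = x∈q
  ... | no  x∉q = contradiction (x , x∈p∧x∉q⇒x∈p─q x∈p x∉q) ¬h

-- Disjointness gives an upper bound and, in `∁p⊆q⇒n≤∣p∣+∣q∣`, covering a lower one; they bound the
-- number of edges at `s` or `t` in an s-t cut of `G′`.
p⊆∁q⇒∣p∣+∣q∣≤n : ∀ (p q : Subset n) → p ⊆ ∁ q → ∣ p ∣ + ∣ q ∣ ≤ n
p⊆∁q⇒∣p∣+∣q∣≤n {n} p q h = begin
  ∣ p ∣ + ∣ q ∣     ≤⟨ +-monoˡ-≤ ∣ q ∣ (p⊆q⇒∣p∣≤∣q∣ h) ⟩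
  ∣ ∁ q ∣ + ∣ q ∣   ≡⟨ cong (_+ ∣ q ∣) (∣∁p∣≡n∸∣p∣ q) ⟩
  n ∸ ∣ q ∣ + ∣ q ∣ ≡⟨ m∸n+n≡m (∣p∣≤n q) ⟩
  n                 ∎
  where open ≤-Reasoning

∁p⊆q⇒n≤∣p∣+∣q∣ : ∀ (p q : Subset n) → ∁ p ⊆ q → n ≤ ∣ p ∣ + ∣ q ∣
∁p⊆q⇒n≤∣p∣+∣q∣ {n} p q h = begin
  n                   ≤⟨ m≤n+m∸n n ∣ p ∣ ⟩
  ∣ p ∣ + (n ∸ ∣ p ∣) ≡⟨ cong (∣ p ∣ +_) (∣∁p∣≡n∸∣p∣ p) ⟨
  ∣ p ∣ + ∣ ∁ p ∣     ≤⟨ +-monoʳ-≤ ∣ p ∣ (p⊆q⇒∣p∣≤∣q∣ h) ⟩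
  ∣ p ∣ + ∣ q ∣       ∎
  where open ≤-Reasoning

∣tabulate∣-splitAt : ∀ m (f : Fin (m + n) → Bool) →
  ∣ tabulate f ∣ ≡ ∣ tabulate (f ∘ (_↑ˡ n)) ∣ + ∣ tabulate (f ∘ (m ↑ʳ_)) ∣
∣tabulate∣-splitAt zero    f = refl
∣tabulate∣-splitAt (suc m) f with f zero
... | true  = cong suc (∣tabulate∣-splitAt m (f ∘ suc))
... | false = ∣tabulate∣-splitAt m (f ∘ suc)

module _ {c ℓ} (M : CommutativeMonoid c ℓ) where
  open CommutativeMonoid M renaming (refl to ≈-refl; sym to ≈-sym; trans to ≈-trans)
  open Sum M

  sum-splitAt : ∀ m (f : Fin (m + n) → Carrier) →
    sum f ≈ sum (f ∘ (_↑ˡ n)) ∙ sum (f ∘ (m ↑ʳ_))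
  sum-splitAt zero    f = ≈-sym (identityˡ _)
  sum-splitAt (suc m) f = ≈-trans (∙-congˡ (sum-splitAt m (f ∘ suc))) (≈-sym (assoc _ _ _))

-- Cuts, walks and paths in an arbitrary graph.

module _ (D : Graph) where

  ∈δ⁺ : ∀ S {e u v} → Joins D e u v → lookup S u xor lookup S v ≡ true → e ∈ δ D S
  ∈δ⁺ S {e} {u} {v} j h = x∈tabulate⁺ (ends-xor j)
    where
    ends-xor : Joins D e u v →
      lookup S (proj₁ (ends D e)) xor lookup S (proj₂ (ends D e)) ≡ true
    ends-xor (inj₁ eq) rewrite eq = h
    ends-xor (inj₂ eq) rewrite eq = trans (xor-comm (lookup S v) _) h

  ∈δ⁻ : ∀ S {e u v} → Joins D e u v → e ∈ δ D S → lookup S u xor lookup S v ≡ true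
  ∈δ⁻ S {e} {u} {v} j e∈ with x∈tabulate⁻ e∈ | j
  ... | h | inj₁ eq rewrite eq = h
  ... | h | inj₂ eq rewrite eq = trans (xor-comm (lookup S u) _) h

  ∉δ : ∀ S {e u v} → Joins D e u v → lookup S u ≡ lookup S v → e ∉ δ D S
  ∉δ S {v = v} j eq e∈ with h ← ∈δ⁻ S j e∈
    rewrite eq | xor-same (lookup S v) with () ← h

  δ-ends : ∀ S {e} → e ∈ δ D S → ∃₂ λ u v → Joins D e u v × u ∈ S × v ∉ S
  δ-ends S {e} e∈ = sides (lookup S u) (lookup S v) refl refl (x∈tabulate⁻ e∈)
    where
    u = proj₁ (ends D e)
    v = proj₂ (ends D e)
    sides : ∀ a b → lookup S u ≡ a → lookup S v ≡ b → a xor b ≡ true →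
      ∃₂ λ u v → Joins D e u v × u ∈ S × v ∉ S
    sides true  false eu ev _ = u , v , inj₁ refl , lookup⇒[]= u S eu , lookup⇒∉ ev
    sides false true  eu ev _ = v , u , inj₂ refl , lookup⇒[]= v S ev , lookup⇒∉ eu

  ∣δ[]∣≡0 : ∀ Z S b → (∀ v → lookup S v ≡ b) → ∣ δ[_] D Z S ∣ ≡ 0
  ∣δ[]∣≡0 Z S b const-S =
    trans (cong ∣_∣ (Empty-unique λ (e , e∈) →
            ∉δ S (inj₁ refl) (trans (const-S _) (sym (const-S _))) (p∩q⊆p _ _ e∈)))
          (∣⊥∣≡0 (#E D))

  -- Either the first edge crosses `S`, or the second node is on the same side as `u` and the rest
  -- of the walk still joins separated nodes.
  walk-crosses : ∀ {Z u v} S → Walk D Z u v → lookup S u xor lookup S v ≡ true →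
    Nonempty (δ[_] D Z S)
  walk-crosses {u = u} S stop h with () ← trans (sym h) (xor-same (lookup S u))
  walk-crosses {u = u} {v} S (step {v = w} e e∈Z j p) h
    with lookup S u xor lookup S w in eq
  ... | true  = e , x∈p∩q⁺ (∈δ⁺ S j eq , e∈Z)
  ... | false = walk-crosses S p (xor-split (lookup S u) _ _ eq h)

  snoc : ∀ {Z u v w} e → Walk D Z u v → e ∈ Z → Joins D e v w → Walk D Z u w
  snoc e stop            e∈Z j = step e e∈Z j stop
  snoc e (step f f∈ i p) e∈Z j = step f f∈ i (snoc e p e∈Z j)

  suffix-path : ∀ {Z u v w} (p : Walk D Z u v) → Unique (nodes D p) →
    w ∈ₗ nodes D p → Path D Z w v
  suffix-path stop            uniq       (here refl) = stop , uniq
  suffix-path (step e e∈ j p) uniq       (here refl) = step e e∈ j p , uniq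
  suffix-path (step e e∈ j p) (_ ∷ uniq) (there w∈p) = suffix-path p uniq w∈p

  -- Cycles are erased starting from the far end: the tail is already simple, so if `u` recurs on
  -- it, the suffix from that occurrence replaces the whole walk.
  walk⇒path : ∀ {Z u v} → Walk D Z u v → Path D Z u v
  walk⇒path stop = stop , [] ∷ []
  walk⇒path {u = u} (step e e∈ j p) with walk⇒path p
  ... | q , uniq with DecMembership._∈?_ _≟_ u (nodes D q)
  ...   | yes u∈q = suffix-path q uniq u∈q
  ...   | no  u∉q = step e e∈ j q , ¬Any⇒All¬ _ u∉q ∷ uniq

  -- Each round adds to `S`, a set of nodes known to be reachable, the outer end of an edge crossing
  -- `S`. The sets increase strictly, so the recursion on `⊃` ends, and it ends only with `t` in
  -- `S`.
  cuts-nonempty⇒walk : ∀ {Z s t} → (∀ S → s ∈ S → t ∉ S → Nonempty (δ[_] D Z S)) →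
    Walk D Z s t
  cuts-nonempty⇒walk {Z} {s} {t} cut =
    grow ⁅ s ⁆ (⊃-wellFounded _) (x∈⁅x⁆ s)
      λ v∈ → subst (Walk D Z s) (sym (x∈⁅y⁆⇒x≡y s v∈)) stop
    where
    grow : ∀ S → Acc _⊃_ S → s ∈ S → (∀ {v} → v ∈ S → Walk D Z s v) → Walk D Z s t
    grow S (acc rec) s∈S reach with t ∈? S
    ... | yes t∈S = reach t∈S
    ... | no  t∉S with cut S s∈S t∉S
    ...   | e , e∈δ[Z] with x∈p∩q⁻ (δ D S) Z e∈δ[Z]
    ...     | e∈δ , e∈Z with δ-ends S e∈δ
    ...       | u , v , j , u∈S , v∉S =
      grow (S ∪ ⁅ v ⁆)
        (rec (p⊆p∪q _ , v , q⊆p∪q _ _ (x∈⁅x⁆ v) , v∉S))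
        (p⊆p∪q _ s∈S)
        λ w∈ → [ reach
               , (λ w∈⁅v⁆ → subst (Walk D Z s) (sym (x∈⁅y⁆⇒x≡y v w∈⁅v⁆))
                              (snoc e (reach u∈S) e∈Z j))
               ]′ (x∈p∪q⁻ S ⁅ v ⁆ w∈)

  separates⇒isCut : ∀ {s t S} → s ∈ S → t ∉ S → IsCut D s t S
  separates⇒isCut {s} {t} {S} s∈S t∉S = trans (cong ∣_∣ (⊆-antisym ⊆⁅s⁆ ⁅s⁆⊆)) (∣⁅x⁆∣≡1 s)
    where
    ⊆⁅s⁆ : S ∩ (⁅ s ⁆ ∪ ⁅ t ⁆) ⊆ ⁅ s ⁆
    ⊆⁅s⁆ x∈ with x∈p∩q⁻ S _ x∈
    ... | x∈S , x∈st =
      [ id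
      , (λ x∈⁅t⁆ → contradiction (subst (_∈ S) (x∈⁅y⁆⇒x≡y t x∈⁅t⁆) x∈S) t∉S)
      ]′ (x∈p∪q⁻ ⁅ s ⁆ ⁅ t ⁆ x∈st)

    ⁅s⁆⊆ : ⁅ s ⁆ ⊆ S ∩ (⁅ s ⁆ ∪ ⁅ t ⁆)
    ⁅s⁆⊆ x∈ = x∈p∩q⁺ (subst (_∈ S) (sym (x∈⁅y⁆⇒x≡y s x∈)) s∈S , p⊆p∪q _ x∈)

  cutRelative⇒pathRelative : ∀ {s t r H} →
    CutRelativeFeasible D s t r H → PathRelativeFeasible D s t r H
  cutRelative⇒pathRelative cut-feasible F F<r (p , _) =
    walk⇒path (cuts-nonempty⇒walk λ S s∈S t∉S →
      cut-feasible F F<r S (separates⇒isCut s∈S t∉S)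
        (walk-crosses S p (cong₂ _xor_ ([]=⇒lookup s∈S) (∉⇒lookup t∉S))))

  -- If the deleted set `F`, all edges of `H` across `S`, had fewer than `r` elements, the surviving
  -- walk would force a path in `H ─ F`; that path has to cross `S` by an edge of `H`, yet all of
  -- these are in `F`.
  pathRelative⇒r≤∣δ[]∣ : ∀ {s t r H} S → PathRelativeFeasible D s t r H →
    lookup S s xor lookup S t ≡ true → Walk D (⊤ ─ δ[_] D H S) s t →
    r ≤ ∣ δ[_] D H S ∣
  pathRelative⇒r≤∣δ[]∣ {H = H} S path-feasible sep p = ≮⇒≥ λ F<r →
    let F = δ[_] D H S
        e , e∈      = walk-crosses S (proj₁ (path-feasible F F<r (walk⇒path p))) sep
        e∈δ , e∈H─F = x∈p∩q⁻ (δ D S) (H ─ F) e∈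
    in x∈p─q⇒x∉q H F e∈H─F (x∈p∩q⁺ (e∈δ , p─q⊆p H F e∈H─F))

-- The edges of the extended graph: old edges and the spokes `sv`, `vt`.

module _ (G : Graph) where
  open Extension G

  oldEdge : Edge G → Edge G′
  oldEdge e = e ↑ˡ (#V G + #V G)

  sEdge tEdge : Node G → Edge G′
  sEdge v = #E G ↑ʳ (v ↑ˡ #V G)
  tEdge v = #E G ↑ʳ (#V G ↑ʳ v)

  star : EdgeSet G′
  star = δ G′ ⁅ s ⁆ ∪ δ G′ ⁅ t ⁆

  data EdgeView : Edge G′ → Set where
    isOld : ∀ e → EdgeView (oldEdge e)
    isS   : ∀ v → EdgeView (sEdge v)
    isT   : ∀ v → EdgeView (tEdge v)

  edgeView : ∀ e → EdgeView e
  edgeView e with splitAt (#E G) e in eq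
  ... | inj₁ e₀ = subst EdgeView (splitAt⁻¹-↑ˡ eq) (isOld e₀)
  ... | inj₂ e₁ with splitAt (#V G) e₁ in eq₁
  ...   | inj₁ v = subst EdgeView (trans (cong (#E G ↑ʳ_) (splitAt⁻¹-↑ˡ eq₁)) (splitAt⁻¹-↑ʳ eq)) (isS v)
  ...   | inj₂ v = subst EdgeView (trans (cong (#E G ↑ʳ_) (splitAt⁻¹-↑ʳ eq₁)) (splitAt⁻¹-↑ʳ eq)) (isT v)

  ends-oldEdge : ∀ e →
    ends G′ (oldEdge e) ≡ (old (proj₁ (ends G e)) , old (proj₂ (ends G e)))
  ends-oldEdge e rewrite splitAt-↑ˡ (#E G) e (#V G + #V G) = refl

  joins-oldEdge : ∀ {e u v} → Joins G e u v → Joins G′ (oldEdge e) (old u) (old v)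
  joins-oldEdge {e} (inj₁ eq) = inj₁ (trans (ends-oldEdge e) (cong (λ (u , v) → old u , old v) eq))
  joins-oldEdge {e} (inj₂ eq) = inj₂ (trans (ends-oldEdge e) (cong (λ (u , v) → old u , old v) eq))

  joins-sEdge : ∀ v → Joins G′ (sEdge v) s (old v)
  joins-sEdge v
    rewrite splitAt-↑ʳ (#E G) (#V G + #V G) (v ↑ˡ #V G)
          | splitAt-↑ˡ (#V G) v (#V G) = inj₁ refl

  joins-tEdge : ∀ v → Joins G′ (tEdge v) (old v) t
  joins-tEdge v
    rewrite splitAt-↑ʳ (#E G) (#V G + #V G) (#V G ↑ʳ v)
          | splitAt-↑ʳ (#V G) (#V G) v = inj₁ refl

  sEdge∈star : ∀ v → sEdge v ∈ star
  sEdge∈star v = p⊆p∪q _ (∈δ⁺ G′ ⁅ s ⁆ (joins-sEdge v) (cong not (lookup-replicate v false)))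

  tEdge∈star : ∀ v → tEdge v ∈ star
  tEdge∈star v = q⊆p∪q (δ G′ ⁅ s ⁆) _
    (∈δ⁺ G′ ⁅ t ⁆ (joins-tEdge v) (cong (_xor true) (lookup-replicate v false)))

  -- Both `⁅ s ⁆` and `⁅ t ⁆` are constant on the old nodes, so neither separates the ends of an old
  -- edge.
  oldEdge∉star : ∀ e → oldEdge e ∉ star
  oldEdge∉star e e∈ = [ avoids ⁅ s ⁆ ⊥-const , avoids ⁅ t ⁆ ⊥-const ]′ (x∈p∪q⁻ _ _ e∈)
    where
    ⊥-const : ∀ u v → lookup (⊥ {#V G}) u ≡ lookup ⊥ v
    ⊥-const u v = trans (lookup-replicate u false) (sym (lookup-replicate v false))
    avoids : ∀ S → (∀ u v → lookup S (old u) ≡ lookup S (old v)) → oldEdge e ∉ δ G′ S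
    avoids S const-S = ∉δ G′ S (joins-oldEdge (inj₁ refl)) (const-S _ _)

  -- Both ends of an old edge are old nodes, so on these edges the restriction made by `induced` is
  -- vacuous.
  ⟨V⟩≡toG : ∀ H → H ⟨V⟩ ≡ toG H
  ⟨V⟩≡toG H = tabulate-cong λ e → begin
    lookup (induced G′ H oldNodes) (oldEdge e)
      ≡⟨ lookup-zipWith _∧_ (oldEdge e) H _ ⟩
    lookup H (oldEdge e) ∧ lookup (tabulate inside²) (oldEdge e)
      ≡⟨ cong (lookup H (oldEdge e) ∧_) (trans (lookup∘tabulate inside² (oldEdge e)) (both e)) ⟩
    lookup H (oldEdge e) ∧ true
      ≡⟨ ∧-identityʳ _ ⟩
    lookup H (oldEdge e) ∎
    where
    open ≡-Reasoning
    inside² : Edge G′ → Bool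
    inside² e = lookup oldNodes (proj₁ (ends G′ e)) ∧ lookup oldNodes (proj₂ (ends G′ e))
    both : ∀ e → inside² (oldEdge e) ≡ true
    both e rewrite ends-oldEdge e =
      cong₂ _∧_ (lookup-replicate (proj₁ (ends G e)) true) (lookup-replicate (proj₂ (ends G e)) true)

  ∈⟨V⟩⁺ : ∀ {H e} → oldEdge e ∈ H → e ∈ H ⟨V⟩
  ∈⟨V⟩⁺ {H} e∈ = subst (_ ∈_) (sym (⟨V⟩≡toG H)) (x∈tabulate⁺ ([]=⇒lookup e∈))

  ∈⟨V⟩⁻ : ∀ {H e} → e ∈ H ⟨V⟩ → oldEdge e ∈ H
  ∈⟨V⟩⁻ {H} {e} e∈ = lookup⇒[]= (oldEdge e) H (x∈tabulate⁻ (subst (_ ∈_) (⟨V⟩≡toG H) e∈))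

  -- Spokes are recorded by their ends in `V`, so that both kinds become subsets of the same
  -- n-element set and can be compared there.
  sEnds tEnds : EdgeSet G′ → NodeSet G
  sEnds Z = tabulate (lookup Z ∘ sEdge)
  tEnds Z = tabulate (lookup Z ∘ tEdge)

  ∣edges∣ : ∀ Z → ∣ Z ∣ ≡ ∣ toG Z ∣ + (∣ sEnds Z ∣ + ∣ tEnds Z ∣)
  ∣edges∣ Z = begin
    ∣ Z ∣
      ≡⟨ cong ∣_∣ (tabulate∘lookup Z) ⟨
    ∣ tabulate (lookup Z) ∣
      ≡⟨ ∣tabulate∣-splitAt (#E G) (lookup Z) ⟩
    ∣ toG Z ∣ + ∣ tabulate (lookup Z ∘ (#E G ↑ʳ_)) ∣
      ≡⟨ cong (∣ toG Z ∣ +_) (∣tabulate∣-splitAt (#V G) _) ⟩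
    ∣ toG Z ∣ + (∣ sEnds Z ∣ + ∣ tEnds Z ∣) ∎
    where open ≡-Reasoning

  -- Sizes of s-t cuts in the extended graph.

  -- The bits `x` and `y`, the sides of `s` and `t`, do not matter because no old edge meets `s` or
  -- `t`.
  toG-δ : ∀ H x y U → toG (δ[_] G′ H (x ∷ y ∷ U)) ≡ δ[_] G (H ⟨V⟩) U
  toG-δ H x y U = ⊆-antisym ⊆δ δ⊆
    where
    S = x ∷ y ∷ U
    ⊆δ : toG (δ[_] G′ H S) ⊆ δ[_] G (H ⟨V⟩) U
    ⊆δ {e} e∈ with x∈p∩q⁻ _ _ (lookup⇒[]= (oldEdge e) (δ[_] G′ H S) (x∈tabulate⁻ e∈))
    ... | e∈δ , e∈H = x∈p∩q⁺
      (∈δ⁺ G U (inj₁ refl) (∈δ⁻ G′ S (joins-oldEdge (inj₁ refl)) e∈δ) , ∈⟨V⟩⁺ e∈H)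
    δ⊆ : δ[_] G (H ⟨V⟩) U ⊆ toG (δ[_] G′ H S)
    δ⊆ e∈ with x∈p∩q⁻ _ _ e∈
    ... | e∈δ , e∈H = x∈tabulate⁺ ([]=⇒lookup (x∈p∩q⁺
      (∈δ⁺ G′ S (joins-oldEdge (inj₁ refl)) (∈δ⁻ G U (inj₁ refl) e∈δ) , ∈⟨V⟩⁻ e∈H)))

  ∣cut∣ : ∀ H x y U → let Z = δ[_] G′ H (x ∷ y ∷ U) in
    ∣ Z ∣ ≡ ∣ δ[_] G (H ⟨V⟩) U ∣ + (∣ sEnds Z ∣ + ∣ tEnds Z ∣)
  ∣cut∣ H x y U = trans (∣edges∣ Z) (cong (λ J → ∣ J ∣ + (∣ sEnds Z ∣ + ∣ tEnds Z ∣)) (toG-δ H x y U))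
    where Z = δ[_] G′ H (x ∷ y ∷ U)

  -- For no `v` do both `sv` and `vt` cross: `s`, `v` and `t` would then lie on three pairwise
  -- different sides. Hence at most n spokes are in the cut, whatever `H` is.
  ∣cut∣-≤ : ∀ H x y U → x xor y ≡ true →
    ∣ δ[_] G′ H (x ∷ y ∷ U) ∣ ≤ ∣ δ[_] G (H ⟨V⟩) U ∣ + #V G
  ∣cut∣-≤ H x y U sep = ≤-trans (≤-reflexive (∣cut∣ H x y U))
    (+-monoʳ-≤ _ (p⊆∁q⇒∣p∣+∣q∣≤n (sEnds Z) (tEnds Z) disjoint))
    where
    S = x ∷ y ∷ U
    Z = δ[_] G′ H S
    lookup-Z⇒∈δ : ∀ e → lookup Z e ≡ true → e ∈ δ G′ S
    lookup-Z⇒∈δ e h = p∩q⊆p (δ G′ S) H (lookup⇒[]= e Z h)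
    disjoint : sEnds Z ⊆ ∁ (tEnds Z)
    disjoint {v} v∈s = x∉p⇒x∈∁p λ v∈t →
      let sv = ∈δ⁻ G′ S (joins-sEdge v) (lookup-Z⇒∈δ _ (x∈tabulate⁻ v∈s))
          vt = ∈δ⁻ G′ S (joins-tEdge v) (lookup-Z⇒∈δ _ (x∈tabulate⁻ v∈t))
      in impossible x (lookup U v) y sv vt sep
      where
      impossible : ∀ a b c → a xor b ≡ true → b xor c ≡ true → ¬ (a xor c ≡ true)
      impossible false true  false _ _ ()
      impossible true  false true  _ _ ()

  -- For each `v` one of `sv`, `vt` crosses, and `H` contains it; hence at least n spokes are
  -- counted.
  ∣cut∣-≥ : ∀ H x y U → H ⊇ star → x xor y ≡ true →
    ∣ δ[_] G (H ⟨V⟩) U ∣ + #V G ≤ ∣ δ[_] G′ H (x ∷ y ∷ U) ∣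
  ∣cut∣-≥ H x y U H⊇ sep = ≤-trans
    (+-monoʳ-≤ _ (∁p⊆q⇒n≤∣p∣+∣q∣ (sEnds Z) (tEnds Z) covers))
    (≤-reflexive (sym (∣cut∣ H x y U)))
    where
    S = x ∷ y ∷ U
    Z = δ[_] G′ H S
    covers : ∁ (sEnds Z) ⊆ tEnds Z
    covers {v} v∉s with x xor lookup U v in eq
    ... | true  = contradiction
      (x∈tabulate⁺ ([]=⇒lookup (x∈p∩q⁺ (∈δ⁺ G′ S (joins-sEdge v) eq , H⊇ (sEdge∈star v)))))
      (x∈∁p⇒x∉p v∉s)
    ... | false = x∈tabulate⁺ ([]=⇒lookup (x∈p∩q⁺
      (∈δ⁺ G′ S (joins-tEdge v) (xor-split x (lookup U v) y eq sep) , H⊇ (tEdge∈star v))))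

  isCut⇒separates : ∀ x y U → IsCut G′ s t (x ∷ y ∷ U) → x xor y ≡ true
  isCut⇒separates true  false U _  = refl
  isCut⇒separates false true  U _  = refl
  isCut⇒separates true  true  U ()
  isCut⇒separates false false U eq
    with () ← trans (sym eq) (trans (cong ∣_∣ (trans (cong (U ∩_) (∪-identityˡ ⊥)) (∩-zeroʳ U))) (∣⊥∣≡0 (#V G)))

  -- Equivalence of the two feasibility notions with condition (iii).

  module _ (k : ℕ) where

    Condition : EdgeSet G′ → Set
    Condition H = H ⊇ star × FeasibleECSS G k (H ⟨V⟩)

    condition⇒cutRelative : ∀ {H} → Condition H → CutRelativeFeasible G′ s t (k + #V G) H
    condition⇒cutRelative {H} (H⊇ , ecss) F F<r S@(x ∷ y ∷ U) cut (e , e∈) =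
      by-view (edgeView e) (x∈p∩q⁻ (δ G′ S) (⊤ ─ F) e∈)
      where
      survives : ∀ {e} → e ∈ star → e ∈ δ G′ S × e ∈ ⊤ ─ F → Nonempty (δ[_] G′ (H ─ F) S)
      survives e∈star (e∈δ , e∉F) =
        _ , x∈p∩q⁺ (e∈δ , x∈p∧x∉q⇒x∈p─q (H⊇ e∈star) (x∈p─q⇒x∉q ⊤ F e∉F))

      by-view : ∀ {e} → EdgeView e → e ∈ δ G′ S × e ∈ ⊤ ─ F → Nonempty (δ[_] G′ (H ─ F) S)
      by-view (isS v) = survives (sEdge∈star v)
      by-view (isT v) = survives (tEdge∈star v)
      -- A crossing old edge shows that `U` is neither empty nor all of `V`, so the k-ECSS condition
      -- applies to it: `H` has at least `k + #V G` edges across `S`, more than `F` can delete.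
      by-view (isOld e₀) (e∈δ , _)
        with δ-ends G U (∈δ⁺ G U (inj₁ refl) (∈δ⁻ G′ S (joins-oldEdge (inj₁ refl)) e∈δ))
      ... | u , v , _ , u∈U , v∉U
        with ∣q∣<∣p∣⇒p─q≢∅ (δ[_] G′ H S) F (begin-strict
          ∣ F ∣                         <⟨ F<r ⟩
          k + #V G                      ≤⟨ +-monoˡ-≤ (#V G) (ecss U (u , u∈U) (⊆⊤ , v , ∈⊤ , v∉U)) ⟩
          ∣ δ[_] G (H ⟨V⟩) U ∣ + #V G   ≤⟨ ∣cut∣-≥ H x y U H⊇ (isCut⇒separates x y U cut) ⟩
          ∣ δ[_] G′ H S ∣               ∎)
        where open ≤-Reasoning
      ... | f , f∈ with x∈p∩q⁻ (δ G′ S) H (p─q⊆p _ F f∈)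
      ... | f∈δ , f∈H = f , x∈p∩q⁺ (f∈δ , x∈p∧x∉q⇒x∈p─q f∈H (x∈p─q⇒x∉q _ F f∈))

    module _ (1≤k : 1 ≤ k)
             (k≤δ : ∀ (S : NodeSet G) → Nonempty S → S ⊂ ⊤ → k ≤ ∣ δ G S ∣)
             {H : EdgeSet G′} (feasible : PathRelativeFeasible G′ s t (k + #V G) H) where

      k≤∣δ[⟨V⟩]∣ : ∀ U → Walk G′ (⊤ ─ δ[_] G′ H (true ∷ false ∷ U)) s t →
        k ≤ ∣ δ[_] G (H ⟨V⟩) U ∣
      k≤∣δ[⟨V⟩]∣ U p = +-cancelʳ-≤ (#V G) k _
        (≤-trans (pathRelative⇒r≤∣δ[]∣ G′ (true ∷ false ∷ U) feasible refl p)
                 (∣cut∣-≤ H true false U refl))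

      -- This lemma and the next give the two reasons for an edge to escape the deletion of the
      -- edges of `H` across `S`; the surviving walks below combine both.
      ∉H⇒survives : ∀ S {e} → e ∉ H → e ∈ ⊤ ─ δ[_] G′ H S
      ∉H⇒survives S e∉H = x∈p∧x∉q⇒x∈p─q ∈⊤ (e∉H ∘ p∩q⊆q (δ G′ S) H)

      ∉δ⇒survives : ∀ S {e} → e ∉ δ G′ S → e ∈ ⊤ ─ δ[_] G′ H S
      ∉δ⇒survives S e∉δ = x∈p∧x∉q⇒x∈p─q ∈⊤ (e∉δ ∘ p∩q⊆p (δ G′ S) H)

      -- U is ∅ or V, so the cut {s} ∪ U is δ(s) or δ(t).
      no-spoke-walk : ∀ U b v → (∀ w → lookup U w ≡ b) →
        let Z = ⊤ ─ δ[_] G′ H (true ∷ false ∷ U) in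
        sEdge v ∈ Z → ¬ (tEdge v ∈ Z)
      no-spoke-walk U b v const-U sv vt =
        <⇒≱ 1≤k (subst (k ≤_) (∣δ[]∣≡0 G (H ⟨V⟩) U b const-U)
          (k≤∣δ[⟨V⟩]∣ U (step _ sv (joins-sEdge v) (step _ vt (joins-tEdge v) stop))))

      pathRelative⇒⊇star : H ⊇ star
      pathRelative⇒⊇star {e} e∈star with e ∈? H
      ... | yes e∈H = e∈H
      ... | no  e∉H with edgeView e
      ...   | isOld e₀ = contradiction e∈star (oldEdge∉star e₀)
      -- With `U` empty, `sv` survives since it is missing from `H`, and `vt` survives since `v` and
      -- `t` are both outside `{s}`.
      ...   | isS v    = contradiction
        (∉δ⇒survives S (∉δ G′ S (joins-tEdge v) (lookup-replicate v false)))
        (no-spoke-walk ⊥ false v (λ w → lookup-replicate w false) (∉H⇒survives S e∉H))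
        where S = true ∷ false ∷ ⊥
      -- Dually, with `U` all of `V`, `vt` is missing from `H` and `sv` has both ends inside the
      -- cut.
      ...   | isT v    = contradiction
        (∉H⇒survives S e∉H)
        (no-spoke-walk ⊤ true v (λ w → lookup-replicate w true)
          (∉δ⇒survives S (∉δ G′ S (joins-sEdge v) (sym (lookup-replicate v true)))))
        where S = true ∷ false ∷ ⊤

      -- If `H ⟨V⟩` contains every edge of `G` across `U`, the connectivity of `G` gives the bound.
      -- Otherwise a missing edge `uv`, with `u` inside and `v` outside `U`, yields the surviving
      -- walk s, u, v, t: its spokes do not cross.
      pathRelative⇒ecss : FeasibleECSS G k (H ⟨V⟩)
      pathRelative⇒ecss U U≢∅ U⊂⊤ with nonempty? (δ G U ─ H ⟨V⟩)
      ... | no none = ≤-trans (k≤δ U U≢∅ U⊂⊤) (p⊆q⇒∣p∣≤∣q∣ δ⊆)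
        where
        δ⊆ : δ G U ⊆ δ[_] G (H ⟨V⟩) U
        δ⊆ {e} e∈δ with e ∈? H ⟨V⟩
        ... | yes e∈H = x∈p∩q⁺ (e∈δ , e∈H)
        ... | no  e∉H = contradiction (e , x∈p∧x∉q⇒x∈p─q e∈δ e∉H) none
      ... | yes (e , e∈) with δ-ends G U (p─q⊆p _ (H ⟨V⟩) e∈)
      ...   | u , v , j , u∈U , v∉U = k≤∣δ[⟨V⟩]∣ U
        (step (sEdge u) (∉δ⇒survives S (∉δ G′ S (joins-sEdge u) (sym ([]=⇒lookup u∈U)))) (joins-sEdge u)
        (step (oldEdge e) (∉H⇒survives S (x∈p─q⇒x∉q (δ G U) _ e∈ ∘ ∈⟨V⟩⁺)) (joins-oldEdge j)
        (step (tEdge v) (∉δ⇒survives S (∉δ G′ S (joins-tEdge v) (∉⇒lookup v∉U))) (joins-tEdge v)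
        stop)))
        where S = true ∷ false ∷ U

  -- The correspondence of solutions, and their costs.

  -- The edges of `G` come first in the numbering of `G′`, so the appended `⊤` consists of all the
  -- spokes.
  extendByStar : EdgeSet G → EdgeSet G′
  extendByStar J = J ++ ⊤

  extendByStar⟨V⟩ : ∀ J → extendByStar J ⟨V⟩ ≡ J
  extendByStar⟨V⟩ J = trans (⟨V⟩≡toG (extendByStar J))
    (trans (tabulate-cong (lookup-++ˡ J ⊤)) (tabulate∘lookup J))

  extendByStar⊇star : ∀ J → extendByStar J ⊇ star
  extendByStar⊇star J {e} e∈star with edgeView e
  ... | isOld e₀ = contradiction e∈star (oldEdge∉star e₀)
  ... | isS v    = lookup⇒[]= _ _ (trans (lookup-++ʳ J ⊤ (v ↑ˡ #V G)) (lookup-replicate (v ↑ˡ #V G) true))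
  ... | isT v    = lookup⇒[]= _ _ (trans (lookup-++ʳ J ⊤ (#V G ↑ʳ v)) (lookup-replicate (#V G ↑ʳ v) true))

  -- Old edges transfer through the equality and spokes lie in `H′` anyway. Used in both directions,
  -- this gives uniqueness of the preimage of a k-ECSS solution.
  ⟨V⟩-reflects-⊆ : ∀ {H H′} → H′ ⊇ star → H ⟨V⟩ ≡ H′ ⟨V⟩ → H ⊆ H′
  ⟨V⟩-reflects-⊆ H′⊇ eq {e} e∈H with edgeView e
  ... | isOld e₀ = ∈⟨V⟩⁻ (subst (e₀ ∈_) eq (∈⟨V⟩⁺ e∈H))
  ... | isS v    = H′⊇ (sEdge∈star v)
  ... | isT v    = H′⊇ (tEdge∈star v)

  module _ {c ℓ₁ ℓ₂} (K : OrderedCommutativeMonoid c ℓ₁ ℓ₂)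
           (cost : Edge G → OrderedCommutativeMonoid.Carrier K) where
    private module K = OrderedCommutativeMonoid K
    open K using (_≈_; ε; _∙_) renaming (_≤_ to _≤ᴷ_)
    open Sum K.commutativeMonoid using (sum; sum-cong-≗; sum-replicate-zero)

    totalCost-⟨V⟩ : ∀ H → totalCost K (extendCost K cost) H ≈ totalCost K cost (H ⟨V⟩)
    totalCost-⟨V⟩ H = begin
      sum price
        ≈⟨ sum-splitAt K.commutativeMonoid (#E G) price ⟩
      sum (price ∘ oldEdge) ∙ sum (price ∘ (#E G ↑ʳ_))
        ≡⟨ cong₂ _∙_ (sum-cong-≗ old-price) (sum-cong-≗ new-price) ⟩
      totalCost K cost (H ⟨V⟩) ∙ sum (const {B = Fin (#V G + #V G)} ε)
        ≈⟨ K.∙-congˡ (sum-replicate-zero (#V G + #V G)) ⟩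
      totalCost K cost (H ⟨V⟩) ∙ ε
        ≈⟨ K.identityʳ _ ⟩
      totalCost K cost (H ⟨V⟩) ∎
      where
      open SetoidReasoning K.setoid
      price : Edge G′ → K.Carrier
      price e = if lookup H e then extendCost K cost e else ε
      old-price : ∀ e → price (oldEdge e) ≡ (if lookup (H ⟨V⟩) e then cost e else ε)
      old-price e
        rewrite ⟨V⟩≡toG H | lookup∘tabulate (lookup H ∘ oldEdge) e
              | splitAt-↑ˡ (#E G) e (#V G + #V G) = refl
      new-price : ∀ i → price (#E G ↑ʳ i) ≡ ε
      new-price i rewrite splitAt-↑ʳ (#E G) (#V G + #V G) i with lookup H (#E G ↑ʳ i)
      ... | true  = refl
      ... | false = refl

    -- Only the equivalence with (iii) enters, so one argument serves both the cut-relative and the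
    -- path-relative problem.
    condition⇒sameAsECSS : ∀ k {Feasible′ : EdgeSet G′ → Set} →
      (∀ H → Feasible′ H ⇔ Condition k H) → SameAsECSS K k cost Feasible′
    condition⇒sameAsECSS k {Feasible′} iff =
        (λ H f → ecss f)
      , (λ H _ → totalCost-⟨V⟩ H)
      , (λ J J-ecss → extendByStar J , (extend-feasible J-ecss , extendByStar⟨V⟩ J)
           , λ {H} (f , H⟨V⟩≡J) →
               let eq = trans (extendByStar⟨V⟩ J) (sym H⟨V⟩≡J)
               in ⊆-antisym (⟨V⟩-reflects-⊆ (⊇star f) eq)
                            (⟨V⟩-reflects-⊆ (extendByStar⊇star J) (sym eq)))
      , (λ H f → mk⇔
           -- Minimality is transported by comparing with `extendByStar J` for a competitor `J` in
           -- `G`, and with `Y ⟨V⟩` for a competitor `Y` in `G′`.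
           (λ (_ , minimal) → ecss f , λ J J-ecss →
              ≤-resp (totalCost-⟨V⟩ H)
                     (K.trans (totalCost-⟨V⟩ (extendByStar J))
                              (K.reflexive (cong (totalCost K cost) (extendByStar⟨V⟩ J))))
                     (minimal (extendByStar J) (extend-feasible J-ecss)))
           (λ (_ , minimal) → f , λ Y Y-feasible →
              ≤-resp (K.sym (totalCost-⟨V⟩ H)) (K.sym (totalCost-⟨V⟩ Y))
                     (minimal (Y ⟨V⟩) (ecss Y-feasible))))
      where
      open IsTotalOrder K.isTotalOrder using (≤-respˡ-≈; ≤-respʳ-≈)
      ⊇star : ∀ {H} → Feasible′ H → H ⊇ star
      ⊇star f = proj₁ (Equivalence.to (iff _) f)
      ecss : ∀ {H} → Feasible′ H → FeasibleECSS G k (H ⟨V⟩)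
      ecss f = proj₂ (Equivalence.to (iff _) f)
      extend-feasible : ∀ {J} → FeasibleECSS G k J → Feasible′ (extendByStar J)
      extend-feasible {J} J-ecss = Equivalence.from (iff _)
        (extendByStar⊇star J , subst (FeasibleECSS G k) (sym (extendByStar⟨V⟩ J)) J-ecss)
      ≤-resp : ∀ {a b a′ b′} → a ≈ a′ → b ≈ b′ → a ≤ᴷ b → a′ ≤ᴷ b′
      ≤-resp a≈a′ b≈b′ = ≤-respˡ-≈ a≈a′ ∘ ≤-respʳ-≈ b≈b′

theorem7p1 :
    ∀ {c ℓ₁ ℓ₂ : Level} (K : OrderedCommutativeMonoid c ℓ₁ ℓ₂) →
    let module K = OrderedCommutativeMonoid K in
    (G : Graph) (cost : Edge G → K.Carrier) → (∀ e → K.ε K.≤ cost e) →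
    (k : ℕ) → 1 ≤ k →
    (∀ (S : NodeSet G) → Nonempty S → S ⊂ ⊤ → k ≤ ∣ δ G S ∣) →
    let open Extension G
        r = k + #V G
    in
    (∀ (H : EdgeSet G′) →
        (CutRelativeFeasible G′ s t r H ⇔ PathRelativeFeasible G′ s t r H)
      × (PathRelativeFeasible G′ s t r H
           ⇔ (H ⊇ (δ G′ ⁅ s ⁆ ∪ δ G′ ⁅ t ⁆) × FeasibleECSS G k (H ⟨V⟩))))
    × SameAsECSS K k cost (CutRelativeFeasible G′ s t r)
    × SameAsECSS K k cost (PathRelativeFeasible G′ s t r)
theorem7p1 K G cost _ k 1≤k k≤δ =
    (λ H → cut⇔path H , path⇔condition H)
  , condition⇒sameAsECSS G K cost k (λ H → path⇔condition H ⇔-∘ cut⇔path H)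
  , condition⇒sameAsECSS G K cost k path⇔condition
  where
  open Extension G

  path⇒condition : ∀ {H} → PathRelativeFeasible G′ s t (k + #V G) H → Condition G k H
  path⇒condition f = pathRelative⇒⊇star G k 1≤k k≤δ f , pathRelative⇒ecss G k 1≤k k≤δ f

  cut⇔path : ∀ H →
    CutRelativeFeasible G′ s t (k + #V G) H ⇔ PathRelativeFeasible G′ s t (k + #V G) H
  cut⇔path H = mk⇔ (cutRelative⇒pathRelative G′)
                   -- The return direction passes through (iii), using the structure of `G′` and the
                   -- connectivity of `G`.
                   (λ f → condition⇒cutRelative G k (path⇒condition f))

  path⇔condition : ∀ H → PathRelativeFeasible G′ s t (k + #V G) H ⇔ Condition G k H
  path⇔condition H = mk⇔ path⇒condition
    (λ h → cutRelative⇒pathRelative G′ (condition⇒cutRelative G k h))
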